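{- Let $v\ge 4$ be a multiple of $3$. The hypergraph $K_v^{(3)}-I$ admits a decomposition into tight $9$-cycles if and only if $v\ge 9$.
   Context: $K_v^{(3)}$ denotes the complete $3$-uniform hypergraph on $v$ vertices (all $3$-element subsets of the vertex set are edges). For $3\mid v$, $K_v^{(3)}-I$ denotes the hypergraph obtained from $K_v^{(3)}$ by deleting the edges of a $1$-factor $I$, i.e. a set of $v/3$ pairwise disjoint triples covering all vertices (the choice of $I$ is irrelevant up to isomorphism). A (3-uniform tight) $k$-cycle is given by a cyclic sequence $v_1,v_2,\dots,v_k$ of $k$ distinct vertices, its edges being the $k$ triples $\{v_i,v_{i+1},v_{i+2}\}$, $i=1,\dots,k$, with indices taken modulo $k$. A decomposition of a hypergraph $\mathcal H$ into $k$-cycles is a collection of $k$-cycles (sub-hypergraphs of $\mathcal H$) whose edge sets partition the edge set of $\mathcal H$. -}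

module Defs where

open import Data.Fin using (Fin; toℕ)
open import Data.Fin.Subset using (Subset; ⁅_⁆; _∪_; _∩_; ∣_∣; Empty) renaming (_∈_ to _∈ˢ_)
open import Data.List using (List; length)
open import Data.List.Membership.Propositional using () renaming (_∈_ to _∈ˡ_)
open import Data.List.Relation.Unary.All using (All)
open import Data.List.Relation.Unary.AllPairs using (AllPairs)
open import Data.List.Relation.Unary.Any using (Any)
open import Data.Nat using (ℕ; _+_; NonZero)
open import Data.Nat.DivMod using (_/_; _mod_)
open import Data.Product using (∃)
open import Function.Definitions using (Injective)
open import Level using (0ℓ)
open import Relation.Binary.PropositionalEquality using (_≡_)
open import Relation.Unary using (Pred; _∈_; _⊆_; _⊥_; _∖_)

-- A hypergraph on the vertex set Fin v, given by its edge set.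
Hypergraph : ℕ → Set₁
Hypergraph v = Pred (Subset v) 0ℓ

K⁽³⁾ : (v : ℕ) → Hypergraph v
K⁽³⁾ v e = ∣ e ∣ ≡ 3

-- The list I represents a set of triples: pairwise disjoint nonempty
-- entries are automatically distinct.
record IsOneFactor {v : ℕ} (I : List (Subset v)) : Set where
  field
    size     : length I ≡ v / 3
    triples  : All (λ e → ∣ e ∣ ≡ 3) I
    disjoint : AllPairs (λ e f → Empty (e ∩ f)) I
    covers   : ∀ (x : Fin v) → Any (x ∈ˢ_) I

infixl 6 _minus_

_minus_ : ∀ {v} → Hypergraph v → List (Subset v) → Hypergraph v
H minus I = H ∖ (_∈ˡ I)

record TightCycle (k v : ℕ) : Set where
  field
    vertex   : Fin k → Fin v
    distinct : Injective _≡_ _≡_ vertex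

module _ {k v : ℕ} .{{_ : NonZero k}} (C : TightCycle k v) where
  open TightCycle C

  cycleEdge : Fin k → Subset v
  cycleEdge i = ⁅ vertex i ⁆ ∪ ⁅ vertex ((toℕ i + 1) mod k) ⁆ ∪ ⁅ vertex ((toℕ i + 2) mod k) ⁆

  edges : Hypergraph v
  edges e = ∃ λ i → e ≡ cycleEdge i

record TightCycleDecomposition (k : ℕ) .{{_ : NonZero k}} {v : ℕ} (H : Hypergraph v) : Set where
  field
    cycles   : List (TightCycle k v)
    within   : All (λ C → edges C ⊆ H) cycles
    disjoint : AllPairs (λ C D → edges C ⊥ edges D) cycles
    covers   : ∀ e → e ∈ H → Any (λ C → e ∈ edges C) cycles

{-# OPTIONS --safe #-}

-- Call the triples of I groups, and let the support of an edge be the set of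
-- groups it meets; the edges of K − I are the triples whose support has two or
-- three elements.  Edges are distributed over the pieces of the decomposition
-- according to their support only.  Order the groups as X, Y and m others.
-- The edges with support in the m others are handled by induction on m.  The
-- edges with a support {X, G, G'} or {Y, G, G'} form copies of K₃,₃,₃, which
-- splits into three cycles.  What remains are the supports meeting {X, Y} and
-- having at most one element outside; taking the other groups in consecutive
-- pairs {W, W'}, each pair contributes a copy of one fixed hypergraph on 12
-- points, and the one or two groups left over absorb the support {X, Y}.
-- The finitely many small hypergraphs needed were decomposed by computer
-- search, imposing invariance under the rotation of all groups.

module Submission where

open import Defs
open import Data.Bool using (T; _∧_; _∨_; _xor_)
open import Data.Bool.Properties using () renaming (_≟_ to _≟ᵇ_)
open import Data.Fin using (Fin; zero; suc; quotient; remainder; combine; lift)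
open import Data.Fin.Properties using (all?; any?; suc-injective; lift-injective; injective⇒≤; remQuot-combine; combine-remQuot; combine-injectiveʳ) renaming (_≟_ to _≟ᶠ_)
open import Data.Fin.Subset using (Subset; inside; outside; ⁅_⁆; ⊥; ⊤; _∪_; _∩_; ∣_∣; Empty) renaming (_∈_ to _∈ˢ_; _∉_ to _∉ˢ_)
open import Data.Fin.Subset.Properties using (anySubset?; Empty-unique; ∉⊥; ∈⊤; x∈⁅x⁆; x∈⁅y⁆⇒x≡y; ∣⁅x⁆∣≡1; ∣⊥∣≡0; ⊆-antisym; ∪-identityˡ; p⊆p∪q; q⊆p∪q; x∈p∪q⁻; x∈p∪q⁺; x∈p∩q⁺; ∣p∣≡n⇒p≡⊤; ∪-identityʳ)
open import Data.List using (List; []; _∷_; _++_; map; concatMap; length) renaming (lookup to lookupˡ)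
open import Data.List.Membership.Propositional using () renaming (_∈_ to _∈ˡ_)
open import Data.List.Membership.Propositional.Properties using (∈-lookup)
open import Data.List.Relation.Unary.All as All using (All; []; _∷_)
import Data.List.Relation.Unary.All.Properties as Allₚ
open import Data.List.Relation.Unary.AllPairs as AllPairs using (AllPairs; []; _∷_; allPairs?)
import Data.List.Relation.Unary.AllPairs.Properties as AllPairsₚ
open import Data.List.Relation.Unary.Any as Any using (Any)
import Data.List.Relation.Unary.Any.Properties as Anyₚ
open import Data.Nat using (ℕ; zero; suc; _+_; _*_; _≤_; _≥_; z≤n; s≤s; NonZero)
open import Data.Nat.Divisibility using (_∣_; divides)
open import Data.Nat.DivMod using (_/_; _%_; _mod_; m*n/n≡m)
open import Data.Nat.Properties using (≤-refl; ≤-trans; ≤-reflexive; n≤1+n) renaming (_≟_ to _≟ⁿ_; suc-injective to ℕ-suc-injective)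
open import Data.Product using (∃; _×_; _,_; proj₁; proj₂)
open import Data.Sum using (_⊎_; inj₁; inj₂; [_,_]′)
open import Data.Vec using (Vec; []; _∷_; here; there; lookup; tabulate; head; tail) renaming (map to mapᵛ)
open import Data.Vec.Properties using (≡-dec; []=⇒lookup; lookup⇒[]=; lookup∘tabulate)
open import Function using (_∘_; id)
open import Function.Bundles using (_⇔_; mk⇔)
open import Function.Definitions using (Injective)
open import Level using (0ℓ)
open import Relation.Binary.PropositionalEquality using (_≡_; _≢_; refl; sym; trans; cong; cong₂; subst; module ≡-Reasoning)
open import Relation.Nullary using (Dec; yes; no; ¬_; ¬?; contradiction)
open import Relation.Nullary.Decidable using (map′; True; toWitness; decidable-stable; _×-dec_; _⊎-dec_; _→-dec_; T?)
open import Relation.Unary using (Pred; Decidable; _⊆_; _≐_) renaming (_⊥_ to _⟂_; _∪_ to _∪ᵖ_)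

private
  variable
    l m n v : ℕ

-- Images of subsets

-- Recursion on the characteristic vector lets images of explicit sets compute, as the finite checks
-- on supports require.
image : (Fin m → Fin n) → Subset m → Subset n
image f []            = ⊥
image f (inside  ∷ p) = ⁅ f zero ⁆ ∪ image (f ∘ suc) p
image f (outside ∷ p) = image (f ∘ suc) p

∈-image⁺ : (f : Fin m → Fin n) {p : Subset m} {x : Fin m} → x ∈ˢ p → f x ∈ˢ image f p
∈-image⁺ f {inside ∷ p}  here       = p⊆p∪q (image (f ∘ suc) p) (x∈⁅x⁆ (f zero))
∈-image⁺ f {inside ∷ p}  (there x∈) = q⊆p∪q ⁅ f zero ⁆ _ (∈-image⁺ (f ∘ suc) x∈)
∈-image⁺ f {outside ∷ p} (there x∈) = ∈-image⁺ (f ∘ suc) x∈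

∈-image⁻ : (f : Fin m → Fin n) (p : Subset m) {y : Fin n} → y ∈ˢ image f p →
  ∃ λ x → x ∈ˢ p × f x ≡ y
∈-image⁻ f [] y∈ = contradiction y∈ ∉⊥
∈-image⁻ f (inside ∷ p) y∈ with x∈p∪q⁻ ⁅ f zero ⁆ _ y∈
... | inj₁ y∈⁅⁆ = zero , here , sym (x∈⁅y⁆⇒x≡y (f zero) y∈⁅⁆)
... | inj₂ y∈im = let x , x∈ , eq = ∈-image⁻ (f ∘ suc) p y∈im in suc x , there x∈ , eq
∈-image⁻ f (outside ∷ p) y∈ = let x , x∈ , eq = ∈-image⁻ (f ∘ suc) p y∈ in suc x , there x∈ , eq

image-unique : (f : Fin m → Fin n) (p : Subset m) {q : Subset n} →
  (∀ {x} → x ∈ˢ p → f x ∈ˢ q) → (∀ {y} → y ∈ˢ q → ∃ λ x → x ∈ˢ p × f x ≡ y) → image f p ≡ q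
image-unique f p to from = ⊆-antisym
  (λ y∈ → let x , x∈ , eq = ∈-image⁻ f p y∈ in subst (_∈ˢ _) eq (to x∈))
  (λ y∈ → let x , x∈ , eq = from y∈ in subst (_∈ˢ _) eq (∈-image⁺ f x∈))

image-cong : {f g : Fin m → Fin n} → (∀ x → f x ≡ g x) → ∀ p → image f p ≡ image g p
image-cong f≗g []            = refl
image-cong f≗g (inside ∷ p)  = cong₂ (λ x → ⁅ x ⁆ ∪_) (f≗g zero) (image-cong (f≗g ∘ suc) p)
image-cong f≗g (outside ∷ p) = image-cong (f≗g ∘ suc) p

image-∘ : (f : Fin m → Fin n) (g : Fin l → Fin m) (p : Subset l) →
  image (f ∘ g) p ≡ image f (image g p)
image-∘ f g p = image-unique (f ∘ g) p
  (∈-image⁺ f ∘ ∈-image⁺ g)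
  (λ y∈ → let z , z∈ , fz≡y = ∈-image⁻ f (image g p) y∈
              x , x∈ , gx≡z = ∈-image⁻ g p z∈
          in  x , x∈ , trans (cong f gx≡z) fz≡y)

image-∪ : (f : Fin m → Fin n) (p q : Subset m) → image f (p ∪ q) ≡ image f p ∪ image f q
image-∪ f p q = image-unique f (p ∪ q)
  (λ x∈ → x∈p∪q⁺ ([ inj₁ ∘ ∈-image⁺ f , inj₂ ∘ ∈-image⁺ f ]′ (x∈p∪q⁻ p q x∈)))
  (λ y∈ → [ (λ y∈p → let x , x∈ , eq = ∈-image⁻ f p y∈p in x , p⊆p∪q q x∈ , eq)
          , (λ y∈q → let x , x∈ , eq = ∈-image⁻ f q y∈q in x , q⊆p∪q p q x∈ , eq)
          ]′ (x∈p∪q⁻ (image f p) (image f q) y∈))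

image-⁅⁆ : (f : Fin m → Fin n) (x : Fin m) → image f ⁅ x ⁆ ≡ ⁅ f x ⁆
image-⁅⁆ f x = image-unique f ⁅ x ⁆
  (λ y∈ → subst (λ z → f z ∈ˢ ⁅ f x ⁆) (sym (x∈⁅y⁆⇒x≡y x y∈)) (x∈⁅x⁆ (f x)))
  (λ y∈ → x , x∈⁅x⁆ x , sym (x∈⁅y⁆⇒x≡y (f x) y∈))

image-suc : (f : Fin m → Fin n) (p : Subset m) → image (suc ∘ f) p ≡ outside ∷ image f p
image-suc f []            = refl
image-suc f (inside ∷ p)  = cong (⁅ suc (f zero) ⁆ ∪_) (image-suc (f ∘ suc) p)
image-suc f (outside ∷ p) = image-suc (f ∘ suc) p

-- `lift (suc k) f` fixes the first point and sends no other point to it, so the first entry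
-- survives. Repeated use computes images under maps that fix an initial block of groups.
image-lift : (k : ℕ) (f : Fin m → Fin n) (s : _) (p : Subset (k + m)) →
  image (lift (suc k) f) (s ∷ p) ≡ s ∷ image (lift k f) p
image-lift k f inside  p = trans (cong (⁅ zero ⁆ ∪_) (image-suc (lift k f) p)) (cong (inside ∷_) (∪-identityˡ _))
image-lift k f outside p = image-suc (lift k f) p

module _ {f : Fin m → Fin n} (f-inj : Injective _≡_ _≡_ f) where

  ∈-image-injective : ∀ {p x} → f x ∈ˢ image f p → x ∈ˢ p
  ∈-image-injective {p} fx∈ =
    let y , y∈ , eq = ∈-image⁻ f p fx∈ in subst (_∈ˢ p) (f-inj eq) y∈

  image-injective : Injective _≡_ _≡_ (image f)
  image-injective eq = ⊆-antisym
    (λ x∈ → ∈-image-injective (subst (_ ∈ˢ_) eq (∈-image⁺ f x∈)))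
    (λ x∈ → ∈-image-injective (subst (_ ∈ˢ_) (sym eq) (∈-image⁺ f x∈)))

image-surjective : (f : Fin m → Fin n) (q : Subset n) → (∀ {y} → y ∈ˢ q → ∃ λ x → f x ≡ y) →
  ∃ λ p → image f p ≡ q
image-surjective f q covered = p , image-unique f p
  (λ {x} x∈ → lookup⇒[]= (f x) q (trans (sym (lookup-p x)) ([]=⇒lookup x∈)))
  (λ {y} y∈ → let x , fx≡y = covered y∈ in
    x , lookup⇒[]= x p (trans (lookup-p x) (trans (cong (lookup q) fx≡y) ([]=⇒lookup y∈))) , fx≡y)
  where
  -- The full preimage of `q`: its characteristic function is that of `q` composed with `f`.
  p = tabulate (lookup q ∘ f)
  lookup-p = lookup∘tabulate (lookup q ∘ f)

-- Cardinalities of images, and enumeration of finite sets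

∣⁅x⁆∪p∣≤ : (x : Fin n) (p : Subset n) → ∣ ⁅ x ⁆ ∪ p ∣ ≤ suc ∣ p ∣
∣⁅x⁆∪p∣≤ zero    (inside ∷ p)  rewrite ∪-identityˡ p = n≤1+n _
∣⁅x⁆∪p∣≤ zero    (outside ∷ p) rewrite ∪-identityˡ p = ≤-refl
∣⁅x⁆∪p∣≤ (suc x) (inside ∷ p)  = s≤s (∣⁅x⁆∪p∣≤ x p)
∣⁅x⁆∪p∣≤ (suc x) (outside ∷ p) = ∣⁅x⁆∪p∣≤ x p

∣⁅x⁆∪p∣≡ : (x : Fin n) (p : Subset n) → x ∉ˢ p → ∣ ⁅ x ⁆ ∪ p ∣ ≡ suc ∣ p ∣
∣⁅x⁆∪p∣≡ zero    (inside ∷ p)  x∉ = contradiction here x∉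
∣⁅x⁆∪p∣≡ zero    (outside ∷ p) x∉ rewrite ∪-identityˡ p = refl
∣⁅x⁆∪p∣≡ (suc x) (inside ∷ p)  x∉ = cong suc (∣⁅x⁆∪p∣≡ x p (x∉ ∘ there))
∣⁅x⁆∪p∣≡ (suc x) (outside ∷ p) x∉ = ∣⁅x⁆∪p∣≡ x p (x∉ ∘ there)

∣image∣≤ : (f : Fin m → Fin n) (p : Subset m) → ∣ image f p ∣ ≤ ∣ p ∣
∣image∣≤ {n = n} f []    = ≤-reflexive (∣⊥∣≡0 n)
∣image∣≤ f (inside ∷ p)  = ≤-trans (∣⁅x⁆∪p∣≤ (f zero) (image (f ∘ suc) p)) (s≤s (∣image∣≤ (f ∘ suc) p))
∣image∣≤ f (outside ∷ p) = ∣image∣≤ (f ∘ suc) p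

∣image∣≡ : {f : Fin m → Fin n} → Injective _≡_ _≡_ f → (p : Subset m) → ∣ image f p ∣ ≡ ∣ p ∣
∣image∣≡ {n = n} f-inj [] = ∣⊥∣≡0 n
∣image∣≡ {f = f} f-inj (inside ∷ p) = trans
  (∣⁅x⁆∪p∣≡ (f zero) _ λ f0∈ → case-zero (proj₂ (proj₂ (∈-image⁻ (f ∘ suc) p f0∈))))
  (cong suc (∣image∣≡ (suc-injective ∘ f-inj) p))
  where
  case-zero : ∀ {x} → f (suc x) ≢ f zero
  case-zero eq with () ← f-inj eq
∣image∣≡ f-inj (outside ∷ p) = ∣image∣≡ (suc-injective ∘ f-inj) p

-- Serves three times: for a triple of groups spanning a copy of K₃,₃,₃, for the points of a triple
-- of `I`, and for a support with one element.
enumerate : ∀ {k} (p : Subset n) → ∣ p ∣ ≡ k →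
  ∃ λ (f : Fin k → Fin n) → Injective _≡_ _≡_ f × image f ⊤ ≡ p
enumerate [] refl = (λ ()) , (λ { {()} }) , refl
enumerate (inside ∷ p) refl =
  let f , f-inj , f⊤≡p = enumerate p refl
  in  lift 1 f , lift-injective f f-inj 1 , trans (image-lift 0 f inside ⊤) (cong (inside ∷_) f⊤≡p)
enumerate (outside ∷ p) ∣p∣≡k =
  let f , f-inj , f⊤≡p = enumerate p ∣p∣≡k
  in  suc ∘ f , f-inj ∘ suc-injective , trans (image-suc f ⊤) (cong (outside ∷_) f⊤≡p)

∣p∣≡0⇒p≡⊥ : (p : Subset n) → ∣ p ∣ ≡ 0 → p ≡ ⊥
∣p∣≡0⇒p≡⊥ []            _  = refl
∣p∣≡0⇒p≡⊥ (outside ∷ p) eq = cong (outside ∷_) (∣p∣≡0⇒p≡⊥ p eq)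

-- Operations on decompositions


Decomposition : Hypergraph v → Set
Decomposition = TightCycleDecomposition 9

decompose-≐ : {H G : Hypergraph v} → H ≐ G → Decomposition H → Decomposition G
decompose-≐ (H⊆G , G⊆H) d = record
  { cycles   = cycles
  ; within   = All.map (λ C⊆H {_} e∈C → H⊆G (C⊆H e∈C)) within
  ; disjoint = disjoint
  ; covers   = λ e e∈G → covers e (G⊆H e∈G)
  }
  where open TightCycleDecomposition d

decompose-∅ : {H : Hypergraph v} → (∀ e → ¬ H e) → Decomposition H
decompose-∅ empty = record
  { cycles = [] ; within = [] ; disjoint = [] ; covers = λ e e∈H → contradiction e∈H (empty e) }

decompose-∪ : {H G : Hypergraph v} → H ⟂ G → Decomposition H → Decomposition G → Decomposition (H ∪ᵖ G)
decompose-∪ H⟂G d₁ d₂ = record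
  { cycles   = D₁.cycles ++ D₂.cycles
  ; within   = Allₚ.++⁺ (All.map (λ C⊆H {_} e∈ → inj₁ (C⊆H e∈)) D₁.within)
                        (All.map (λ C⊆G {_} e∈ → inj₂ (C⊆G e∈)) D₂.within)
  ; disjoint = AllPairsₚ.++⁺ D₁.disjoint D₂.disjoint
      (All.map (λ C⊆H → All.map (λ D⊆G {_} (e∈C , e∈D) → H⟂G (C⊆H e∈C , D⊆G e∈D)) D₂.within) D₁.within)
  ; covers   = λ e → [ Anyₚ.++⁺ˡ ∘ D₁.covers e , Anyₚ.++⁺ʳ D₁.cycles ∘ D₂.covers e ]′
  }
  where
  module D₁ = TightCycleDecomposition d₁
  module D₂ = TightCycleDecomposition d₂

-- Keys take finitely many values: splitting on the first bit leaves two disjoint hypergraphs with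
-- shorter keys, and the empty key separates nothing.
decompose-fibres : {H : Hypergraph v} (key : Subset v → Subset n) →
  (∀ k → Decomposition (λ e → H e × key e ≡ k)) → Decomposition H
decompose-fibres {n = zero} key d =
  decompose-≐ (proj₁ , λ {e} e∈H → e∈H , []-unique (key e)) (d [])
  where
  []-unique : (k : Subset 0) → k ≡ []
  []-unique [] = refl
decompose-fibres {n = suc n} {H = H} key d = decompose-≐
  ([ proj₁ , proj₁ ]′ , λ {e} e∈H → split e∈H (key e) refl)
  (decompose-∪ (λ ((_ , eq) , (_ , eq′)) → inside≢outside (trans (sym eq) eq′))
    (half inside) (half outside))
  where
  inside≢outside : inside ≢ outside
  inside≢outside ()

  half : ∀ s → Decomposition (λ e → H e × head (key e) ≡ s)
  half s = decompose-fibres (tail ∘ key) λ k → decompose-≐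
    ( (λ (e∈H , eq) → (e∈H , cong head eq) , cong tail eq)
    , (λ {e} ((e∈H , eq) , eq′) → e∈H , join (key e) eq eq′))
    (d (s ∷ k))
    where
    join : ∀ (k′ : Subset (suc n)) {s k} → head k′ ≡ s → tail k′ ≡ k → k′ ≡ s ∷ k
    join (_ ∷ _) refl refl = refl

  split : ∀ {e} → H e → ∀ k → key e ≡ k →
    (H e × head (key e) ≡ inside) ⊎ (H e × head (key e) ≡ outside)
  split e∈H (inside ∷ _)  eq = inj₁ (e∈H , cong head eq)
  split e∈H (outside ∷ _) eq = inj₂ (e∈H , cong head eq)

Push : (Fin m → Fin n) → Hypergraph m → Hypergraph n
Push f H e′ = ∃ λ e → H e × e′ ≡ image f e

module _ {f : Fin m → Fin n} (f-inj : Injective _≡_ _≡_ f) where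

  mapCycle : TightCycle 9 m → TightCycle 9 n
  mapCycle C = record { vertex = f ∘ vertex ; distinct = distinct ∘ f-inj }
    where open TightCycle C

  cycleEdge-mapCycle : ∀ C i → cycleEdge (mapCycle C) i ≡ image f (cycleEdge C i)
  cycleEdge-mapCycle C i = sym (image-triple _ _ _)
    where
    image-triple : ∀ x y z → image f (⁅ x ⁆ ∪ ⁅ y ⁆ ∪ ⁅ z ⁆) ≡ ⁅ f x ⁆ ∪ ⁅ f y ⁆ ∪ ⁅ f z ⁆
    image-triple x y z = trans (image-∪ f ⁅ x ⁆ (⁅ y ⁆ ∪ ⁅ z ⁆)) (cong₂ _∪_ (image-⁅⁆ f x)
      (trans (image-∪ f ⁅ y ⁆ ⁅ z ⁆) (cong₂ _∪_ (image-⁅⁆ f y) (image-⁅⁆ f z))))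

  edges-mapCycle⁻ : ∀ C {e} → edges (mapCycle C) e → Push f (edges C) e
  edges-mapCycle⁻ C (i , eq) = cycleEdge C i , (i , refl) , trans eq (cycleEdge-mapCycle C i)

  edges-mapCycle⁺ : ∀ C {e} → Push f (edges C) e → edges (mapCycle C) e
  edges-mapCycle⁺ C (_ , (i , refl) , eq) = i , trans eq (sym (cycleEdge-mapCycle C i))

  -- Injectivity of `f` enters twice: the vertices of a cycle stay distinct, and edges of different
  -- cycles stay different because `image f` is injective too.
  decompose-push : {H : Hypergraph m} → Decomposition H → Decomposition (Push f H)
  decompose-push d = record
    { cycles   = map mapCycle cycles
    ; within   = Allₚ.map⁺ (All.map
        (λ {C} C⊆H {_} e∈ → let e₀ , e₀∈C , eq = edges-mapCycle⁻ C e∈ in e₀ , C⊆H e₀∈C , eq) within)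
    ; disjoint = AllPairsₚ.map⁺ (AllPairs.map
        (λ {C} {D} C⟂D {_} (e∈C , e∈D) →
          let e₁ , e₁∈C , eq₁ = edges-mapCycle⁻ C e∈C
              e₂ , e₂∈D , eq₂ = edges-mapCycle⁻ D e∈D
          in  C⟂D (e₁∈C , subst (edges D) (image-injective f-inj (trans (sym eq₂) eq₁)) e₂∈D)) disjoint)
    ; covers   = λ e′ (e , e∈H , eq) →
        Anyₚ.map⁺ (Any.map (λ {C} e∈C → edges-mapCycle⁺ C (e , e∈C , eq)) (covers e e∈H))
    }
    where open TightCycleDecomposition d

-- Hypergraphs determined by supports.  Group i consists of the vertices
-- 3 i, 3 i + 1 and 3 i + 2.

supp : ∀ m → Subset (m * 3) → Subset m
supp m = image (quotient 3)

⟨_⟩ : Pred (Subset m) 0ℓ → Hypergraph (m * 3)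
⟨_⟩ {m} S e = ∣ e ∣ ≡ 3 × S (supp m e)

Good : ∀ m → Pred (Subset m) 0ℓ → Set
Good m S = Decomposition ⟨ S ⟩

good-∪ : {S S₁ S₂ : Pred (Subset m) 0ℓ} → S ≐ S₁ ∪ᵖ S₂ → S₁ ⟂ S₂ → Good m S₁ → Good m S₂ → Good m S
good-∪ (to , from) disj g₁ g₂ = decompose-≐
  ( [ (λ (∣e∣ , s) → ∣e∣ , from (inj₁ s)) , (λ (∣e∣ , s) → ∣e∣ , from (inj₂ s)) ]′
  , (λ (∣e∣ , s) → [ (λ s₁ → inj₁ (∣e∣ , s₁)) , (λ s₂ → inj₂ (∣e∣ , s₂)) ]′ (to s)))
  (decompose-∪ (λ ((_ , s₁) , (_ , s₂)) → disj (s₁ , s₂)) g₁ g₂)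

module _ {φ : Fin l → Fin m} (φ-inj : Injective _≡_ _≡_ φ) where

  onGroups : Fin (l * 3) → Fin (m * 3)
  onGroups x = combine (φ (quotient 3 x)) (remainder {l} 3 x)

  quotient-onGroups : ∀ x → quotient 3 (onGroups x) ≡ φ (quotient 3 x)
  quotient-onGroups x = cong proj₁ (remQuot-combine (φ (quotient 3 x)) (remainder {l} 3 x))

  onGroups-combine : ∀ i r → onGroups (combine i r) ≡ combine (φ i) r
  onGroups-combine i r = cong (λ (i , r) → combine (φ i) r) (remQuot-combine i r)

  onGroups-injective : Injective _≡_ _≡_ onGroups
  onGroups-injective {x} {y} eq = begin
    x                                                  ≡⟨ combine-remQuot {l} 3 x ⟨
    combine (quotient {l} 3 x) (remainder {l} 3 x)     ≡⟨ cong₂ combine same-group same-place ⟩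
    combine (quotient {l} 3 y) (remainder {l} 3 y)     ≡⟨ combine-remQuot {l} 3 y ⟩
    y                                                  ∎
    where
    open ≡-Reasoning
    same-group : quotient 3 x ≡ quotient 3 y
    same-group = φ-inj (trans (sym (quotient-onGroups x)) (trans (cong (quotient 3) eq) (quotient-onGroups y)))
    remainder-onGroups : ∀ x → remainder {m} 3 (onGroups x) ≡ remainder {l} 3 x
    remainder-onGroups x = cong proj₂ (remQuot-combine (φ (quotient 3 x)) (remainder {l} 3 x))
    same-place : remainder {l} 3 x ≡ remainder {l} 3 y
    same-place = trans (sym (remainder-onGroups x)) (trans (cong (remainder {m} 3) eq) (remainder-onGroups y))

  supp-onGroups : ∀ e → supp m (image onGroups e) ≡ image φ (supp l e)
  supp-onGroups e = begin
    image (quotient 3) (image onGroups e)  ≡⟨ image-∘ (quotient 3) onGroups e ⟨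
    image (quotient 3 ∘ onGroups) e        ≡⟨ image-cong quotient-onGroups e ⟩
    image (φ ∘ quotient 3) e               ≡⟨ image-∘ φ (quotient 3) e ⟩
    image φ (supp l e)                     ∎
    where open ≡-Reasoning

  -- The support of a pushed edge is the `φ`-image of its support. The two hypotheses say that `S′`
  -- is the image of `S`; leaving `S′` free allows predicates defined by pattern matching.
  good-push : {S : Pred (Subset l) 0ℓ} {S′ : Pred (Subset m) 0ℓ} →
    (∀ {σ} → S σ → S′ (image φ σ)) → (∀ {τ} → S′ τ → ∃ λ σ → S σ × image φ σ ≡ τ) →
    Good l S → Good m S′
  good-push {S} {S′} to from g = decompose-≐ (⊆₁ , ⊆₂) (decompose-push onGroups-injective g)
    where
    ⊆₁ : Push onGroups ⟨ S ⟩ ⊆ ⟨ S′ ⟩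
    ⊆₁ (e , (∣e∣≡3 , s) , refl) =
      trans (∣image∣≡ onGroups-injective e) ∣e∣≡3 , subst S′ (sym (supp-onGroups e)) (to s)

    ⊆₂ : ⟨ S′ ⟩ ⊆ Push onGroups ⟨ S ⟩
    ⊆₂ {e′} (∣e′∣≡3 , s′) with from s′
    ... | σ , s , φσ≡ with image-surjective onGroups e′ covered
      where
      -- `φ` need not reach every group, but it reaches those in the support of `e′`, hence
      -- `onGroups` reaches every vertex of `e′`.
      covered : ∀ {y} → y ∈ˢ e′ → ∃ λ x → onGroups x ≡ y
      covered {y} y∈ =
        let i , _ , φi≡ = ∈-image⁻ φ σ (subst (_ ∈ˢ_) (sym φσ≡) (∈-image⁺ (quotient 3) y∈))
        in  combine i (remainder {m} 3 y) , trans (onGroups-combine i (remainder {m} 3 y))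
              (trans (cong (λ j → combine j (remainder {m} 3 y)) φi≡) (combine-remQuot {m} 3 y))
    ... | e , refl =
      e , (trans (sym (∣image∣≡ onGroups-injective e)) ∣e′∣≡3
          , subst S (image-injective φ-inj (trans φσ≡ (supp-onGroups e))) s) , refl

-- Decompositions of small hypergraphs, verified by evaluation

all-subsets? : {P : Pred (Subset n) 0ℓ} → Decidable P → Dec (∀ e → P e)
all-subsets? P? = map′
  (λ ¬∃ e → decidable-stable (P? e) (λ ¬p → ¬∃ (e , ¬p)))
  (λ ∀p (e , ¬p) → ¬p (∀p e))
  (¬? (anySubset? (¬? ∘ P?)))

module _ {H : Hypergraph v} (H? : Decidable H) where

  edge? : (C : TightCycle 9 v) → Decidable (edges C)
  edge? C e = any? λ i → ≡-dec _≟ᵇ_ e (cycleEdge C i)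

  -- A form suited to evaluation: containment and disjointness range over the nine positions of a
  -- cycle, and only covering runs through all subsets.
  IsDecomposition : List (TightCycle 9 v) → Set
  IsDecomposition cs =
      All (λ C → ∀ i → H (cycleEdge C i)) cs
    × AllPairs (λ C D → ∀ i → ¬ edges D (cycleEdge C i)) cs
    × (∀ e → H e → Any (λ C → edges C e) cs)

  isDecomposition? : Decidable IsDecomposition
  isDecomposition? cs =
          All.all? (λ C → all? (H? ∘ cycleEdge C)) cs
    ×-dec allPairs? (λ C D → all? λ i → ¬? (edge? D (cycleEdge C i))) cs
    ×-dec all-subsets? λ e → H? e →-dec Any.any? (λ C → edge? C e) cs

  isDecomposition⇒decomposition : ∀ cs → IsDecomposition cs → Decomposition H
  isDecomposition⇒decomposition cs (within , disjoint , covers) = record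
    { cycles   = cs
    ; within   = All.map (λ w {_} (i , eq) → subst H (sym eq) (w i)) within
    ; disjoint = AllPairs.map (λ {C} {D} d {_} ((i , eq) , e∈D) → d i (subst (edges D) eq e∈D)) disjoint
    ; covers   = covers
    }

module _ (k : ℕ) .{{_ : NonZero k}} where

  -- Reduction mod `k` merely turns a literal into an element of `Fin k`; all entries of the tables
  -- below are already smaller than `k`.
  vertexAt : Vec ℕ 9 → Fin 9 → Fin k
  vertexAt xs i = lookup xs i mod k

  Distinct : Vec ℕ 9 → Set
  Distinct xs = ∀ i j → vertexAt xs i ≡ vertexAt xs j → i ≡ j

  distinct? : Decidable Distinct
  distinct? xs = all? λ i → all? λ j → (vertexAt xs i ≟ᶠ vertexAt xs j) →-dec (i ≟ᶠ j)

  fromRows : ∀ {rows} → All Distinct rows → List (TightCycle 9 k)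
  fromRows = All.reduce λ {xs} d → record { vertex = vertexAt xs ; distinct = λ {i} {j} → d i j }

  -- Proof by reflection: when a check succeeds its `True` type evaluates to the unit type, so an
  -- underscore supplies the argument.
  decompose-rows : ∀ {H} (H? : Decidable H) rows (d : True (All.all? distinct? rows)) →
    True (isDecomposition? H? (fromRows (toWitness d))) → Decomposition H
  decompose-rows H? rows d ok = isDecomposition⇒decomposition H? (fromRows (toWitness d)) (toWitness ok)

⟨_⟩? : {S : Pred (Subset m) 0ℓ} → Decidable S → Decidable ⟨ S ⟩
⟨ S? ⟩? e = (∣ e ∣ ≟ⁿ 3) ×-dec S? (supp _ e)

-- The cyclic shift inside each group: 3i + r goes to 3i + (r + 1 mod 3). It has order three and
-- maps each group to itself, so it preserves every hypergraph given by supports.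
rotate : ℕ → ℕ
rotate x = x / 3 * 3 + suc x % 3

orbit : Vec ℕ 9 → List (Vec ℕ 9)
orbit xs = xs ∷ mapᵛ rotate xs ∷ mapᵛ (rotate ∘ rotate) xs ∷ []

-- The first two entries of a support stand for the groups X and Y.

Full : Pred (Subset m) 0ℓ
Full σ = ∣ σ ∣ ≡ 2 ⊎ ∣ σ ∣ ≡ 3

full? : Decidable (Full {m})
full? σ = (∣ σ ∣ ≟ⁿ 2) ⊎-dec (∣ σ ∣ ≟ⁿ 3)

Spokes : Pred (Subset (2 + m)) 0ℓ
Spokes (x ∷ y ∷ σ) = T (x ∨ y) × ∣ σ ∣ ≡ 1

spokes? : Decidable (Spokes {m})
spokes? (x ∷ y ∷ σ) = T? (x ∨ y) ×-dec (∣ σ ∣ ≟ⁿ 1)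

Hub : Pred (Subset (2 + m)) 0ℓ
Hub (x ∷ y ∷ σ) = T (x ∧ y) × ∣ σ ∣ ≡ 0

hub? : Decidable (Hub {m})
hub? (x ∷ y ∷ σ) = T? (x ∧ y) ×-dec (∣ σ ∣ ≟ⁿ 0)

-- The hub occurs once, whereas the spokes grow with the number of further groups; enlarging a wheel
-- therefore only adds spokes.
Wheel : Pred (Subset (2 + m)) 0ℓ
Wheel σ = Spokes σ ⊎ Hub σ

wheel? : Decidable (Wheel {m})
wheel? σ = spokes? σ ⊎-dec hub? σ

Fans : Pred (Subset (2 + m)) 0ℓ
Fans (x ∷ y ∷ σ) = T (x xor y) × ∣ σ ∣ ≡ 2

fans? : Decidable (Fans {m})
fans? (x ∷ y ∷ σ) = T? (x xor y) ×-dec (∣ σ ∣ ≟ⁿ 2)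

-- Explicit decompositions on 9 and 12 points

abstract

  -- Rotation carries each row to itself, shifted by three places. The 27 edges form nine rotation
  -- orbits, and each row covers three of them.
  K₃₃₃ : Good 3 (_≡ ⊤)
  K₃₃₃ = decompose-rows 9 ⟨ (λ σ → ≡-dec _≟ᵇ_ σ ⊤) ⟩?
    ( (0 ∷ 3 ∷ 6 ∷ 1 ∷ 4 ∷ 7 ∷ 2 ∷ 5 ∷ 8 ∷ [])
    ∷ (0 ∷ 4 ∷ 8 ∷ 1 ∷ 5 ∷ 6 ∷ 2 ∷ 3 ∷ 7 ∷ [])
    ∷ (0 ∷ 5 ∷ 7 ∷ 1 ∷ 3 ∷ 8 ∷ 2 ∷ 4 ∷ 6 ∷ [])
    ∷ []) _ _

  -- With one further group the wheel is all of K - I on 9 points: 81 edges, hence nine cycles in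
  -- three orbits.
  wheel₃ : Good 3 Wheel
  wheel₃ = decompose-rows 9 ⟨ wheel? ⟩? (concatMap orbit
    ( (8 ∷ 0 ∷ 7 ∷ 6 ∷ 3 ∷ 2 ∷ 1 ∷ 5 ∷ 4 ∷ [])
    ∷ (4 ∷ 5 ∷ 0 ∷ 7 ∷ 3 ∷ 8 ∷ 2 ∷ 1 ∷ 6 ∷ [])
    ∷ (6 ∷ 3 ∷ 4 ∷ 1 ∷ 2 ∷ 7 ∷ 8 ∷ 5 ∷ 0 ∷ [])
    ∷ [])) _ _

  -- There are 144 edges, hence 16 cycles: one that is fixed by rotation and five orbits of three.
  wheel₄ : Good 4 Wheel
  wheel₄ = decompose-rows 12 ⟨ wheel? ⟩?
    ( (5 ∷ 0 ∷ 6 ∷ 3 ∷ 1 ∷ 7 ∷ 4 ∷ 2 ∷ 8 ∷ [])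
    ∷ concatMap orbit
    ( (6 ∷ 8 ∷ 0 ∷ 2 ∷ 9 ∷ 1 ∷ 10 ∷ 5 ∷ 4 ∷ [])
    ∷ (3 ∷ 6 ∷ 7 ∷ 0 ∷ 5 ∷ 4 ∷ 1 ∷ 8 ∷ 2 ∷ [])
    ∷ (3 ∷ 6 ∷ 8 ∷ 1 ∷ 0 ∷ 5 ∷ 9 ∷ 11 ∷ 4 ∷ [])
    ∷ (7 ∷ 3 ∷ 4 ∷ 10 ∷ 0 ∷ 9 ∷ 1 ∷ 5 ∷ 2 ∷ [])
    ∷ (3 ∷ 9 ∷ 11 ∷ 1 ∷ 4 ∷ 2 ∷ 10 ∷ 5 ∷ 0 ∷ [])
    ∷ [])) _ _

  -- Without the 18 edges of the hub there remain 126, hence 14 cycles: two fixed by rotation and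
  -- four orbits of three.
  spokes₄ : Good 4 Spokes
  spokes₄ = decompose-rows 12 ⟨ spokes? ⟩?
    ( (5 ∷ 0 ∷ 6 ∷ 3 ∷ 1 ∷ 7 ∷ 4 ∷ 2 ∷ 8 ∷ [])
    ∷ (1 ∷ 4 ∷ 10 ∷ 2 ∷ 5 ∷ 11 ∷ 0 ∷ 3 ∷ 9 ∷ [])
    ∷ concatMap orbit
    ( (0 ∷ 3 ∷ 7 ∷ 2 ∷ 1 ∷ 11 ∷ 9 ∷ 4 ∷ 10 ∷ [])
    ∷ (0 ∷ 5 ∷ 10 ∷ 3 ∷ 4 ∷ 6 ∷ 8 ∷ 1 ∷ 7 ∷ [])
    ∷ (9 ∷ 3 ∷ 4 ∷ 8 ∷ 5 ∷ 7 ∷ 2 ∷ 0 ∷ 10 ∷ [])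
    ∷ (3 ∷ 6 ∷ 7 ∷ 1 ∷ 5 ∷ 9 ∷ 0 ∷ 11 ∷ 2 ∷ [])
    ∷ [])) _ _

  -- This is K - I on 12 points: 216 edges, hence 24 cycles in eight orbits.
  full₄ : Good 4 Full
  full₄ = decompose-rows 12 ⟨ full? ⟩? (concatMap orbit
    ( (8 ∷ 0 ∷ 7 ∷ 5 ∷ 11 ∷ 10 ∷ 3 ∷ 1 ∷ 9 ∷ [])
    ∷ (10 ∷ 3 ∷ 9 ∷ 5 ∷ 6 ∷ 1 ∷ 0 ∷ 11 ∷ 8 ∷ [])
    ∷ (11 ∷ 0 ∷ 9 ∷ 6 ∷ 2 ∷ 8 ∷ 1 ∷ 4 ∷ 3 ∷ [])
    ∷ (8 ∷ 0 ∷ 1 ∷ 10 ∷ 5 ∷ 4 ∷ 7 ∷ 11 ∷ 6 ∷ [])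
    ∷ (9 ∷ 0 ∷ 7 ∷ 4 ∷ 8 ∷ 3 ∷ 11 ∷ 6 ∷ 10 ∷ [])
    ∷ (10 ∷ 6 ∷ 7 ∷ 5 ∷ 2 ∷ 1 ∷ 4 ∷ 11 ∷ 0 ∷ [])
    ∷ (1 ∷ 9 ∷ 0 ∷ 3 ∷ 4 ∷ 2 ∷ 8 ∷ 5 ∷ 7 ∷ [])
    ∷ (1 ∷ 5 ∷ 0 ∷ 8 ∷ 10 ∷ 4 ∷ 7 ∷ 3 ∷ 11 ∷ [])
    ∷ [])) _ _

-- Sort the edges by support. The fibre over a triple of groups in `S` is a copy of K₃,₃,₃, and
-- every other fibre is empty.
good-triples : {S : Pred (Subset m) 0ℓ} → Decidable S → (∀ σ → S σ → ∣ σ ∣ ≡ 3) → Good m S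
good-triples {m} {S} S? size = decompose-fibres (supp m) λ τ → decompose-≐
  ((λ (∣e∣ , s , eq) → (∣e∣ , s) , eq) , (λ ((∣e∣ , s) , eq) → ∣e∣ , s , eq)) (fibre τ)
  where
  fibre : ∀ τ → Good m (λ σ → S σ × σ ≡ τ)
  fibre τ with S? τ
  ... | no ¬s = decompose-∅ λ { e (_ , s , refl) → ¬s s }
  ... | yes s =
    let φ , φ-inj , φ⊤≡τ = enumerate τ (size τ s)
    in  good-push φ-inj {_≡ ⊤} {λ σ → S σ × σ ≡ τ} (λ { refl → subst S (sym φ⊤≡τ) s , φ⊤≡τ })
          (λ (_ , eq) → ⊤ , refl , trans φ⊤≡τ (sym eq)) K₃₃₃

good-fans : ∀ m → Good (2 + m) Fans
good-fans m = good-triples fans? size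
  where
  size : ∀ σ → Fans σ → ∣ σ ∣ ≡ 3
  size (inside  ∷ outside ∷ σ) (_ , eq) = cong suc eq
  size (outside ∷ inside  ∷ σ) (_ , eq) = cong suc eq

-- Enlarging a wheel by two groups

raise₂ : Fin m → Fin (2 + m)
raise₂ i = suc (suc i)

raise₂-injective : Injective _≡_ _≡_ (raise₂ {m})
raise₂-injective = suc-injective ∘ suc-injective

image-raise₂ : (σ : Subset m) → image raise₂ σ ≡ outside ∷ outside ∷ σ
image-raise₂ σ = begin
  image raise₂ σ                     ≡⟨ image-suc suc σ ⟩
  outside ∷ image suc σ              ≡⟨ cong (outside ∷_) (image-suc id σ) ⟩
  outside ∷ outside ∷ image id σ     ≡⟨ cong (λ τ → outside ∷ outside ∷ τ) (image-unique id σ id (λ x∈ → _ , x∈ , refl)) ⟩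
  outside ∷ outside ∷ σ              ∎
  where open ≡-Reasoning

-- The new groups W and W′ stand directly behind X and Y. The equation with `⊥` lets a single `refl`
-- fix both of their entries as `outside`.
Skip : Pred (Subset (2 + m)) 0ℓ → Pred (Subset (4 + m)) 0ℓ
Skip S (x ∷ y ∷ w ∷ w′ ∷ σ) = w ∷ w′ ∷ [] ≡ ⊥ × S (x ∷ y ∷ σ)

good-skip : {S : Pred (Subset (2 + m)) 0ℓ} → Good (2 + m) S → Good (4 + m) (Skip S)
-- The map fixes X and Y and moves the other groups past W and W′.
good-skip {m} {S} = good-push (lift-injective raise₂ raise₂-injective 2) {S} {Skip S} to from
  where
  image-skip : ∀ x y σ → image (lift 2 raise₂) (x ∷ y ∷ σ) ≡ x ∷ y ∷ outside ∷ outside ∷ σ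
  image-skip x y σ = trans (image-lift 1 raise₂ x (y ∷ σ)) (cong (x ∷_)
    (trans (image-lift 0 raise₂ y σ) (cong (y ∷_) (image-raise₂ σ))))
  to : ∀ {σ} → S σ → Skip S (image (lift 2 raise₂) σ)
  to {x ∷ y ∷ σ} s = subst (Skip S) (sym (image-skip x y σ)) (refl , s)
  from : ∀ {τ} → Skip S τ → ∃ λ σ → S σ × image (lift 2 raise₂) σ ≡ τ
  from {x ∷ y ∷ w ∷ w′ ∷ σ} (refl , s) = x ∷ y ∷ σ , s , image-skip x y σ

FirstSpokes : Pred (Subset (4 + m)) 0ℓ
FirstSpokes (x ∷ y ∷ w ∷ w′ ∷ σ) = Spokes (x ∷ y ∷ w ∷ w′ ∷ []) × σ ≡ ⊥

good-firstSpokes : ∀ m → Good (4 + m) FirstSpokes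
good-firstSpokes m =
  -- Lifting the empty map by 4 gives the inclusion of the groups X, Y, W, W′ as an initial segment.
  good-push (lift-injective none (λ { {()} }) 4) {Spokes} {FirstSpokes} to from spokes₄
  where
  none : Fin 0 → Fin m
  none ()
  image-first : ∀ x y w w′ → image (lift 4 none) (x ∷ y ∷ w ∷ w′ ∷ []) ≡ x ∷ y ∷ w ∷ w′ ∷ ⊥
  image-first x y w w′ =
    trans (image-lift 3 none x (y ∷ w ∷ w′ ∷ [])) (cong (x ∷_)
    (trans (image-lift 2 none y (w ∷ w′ ∷ [])) (cong (y ∷_)
    (trans (image-lift 1 none w (w′ ∷ [])) (cong (w ∷_)
    (image-lift 0 none w′ []))))))
  to : ∀ {σ} → Spokes σ → FirstSpokes (image (lift 4 none) σ)
  to {x ∷ y ∷ w ∷ w′ ∷ []} s = subst FirstSpokes (sym (image-first x y w w′)) (s , refl)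
  from : ∀ {τ} → FirstSpokes τ → ∃ λ σ → Spokes σ × image (lift 4 none) σ ≡ τ
  from {x ∷ y ∷ w ∷ w′ ∷ _} (s , refl) = x ∷ y ∷ w ∷ w′ ∷ [] , s , image-first x y w w′

-- A support in the wheel has at most one group outside X and Y. Either it avoids both W and W′, or
-- that group is one of them and the support is a spoke without any later group.
wheel-step : ∀ m → Good (2 + m) Wheel → Good (4 + m) Wheel
wheel-step m g = good-∪ {S₁ = Skip Wheel} {S₂ = FirstSpokes}
  ((λ {σ} → to σ) , (λ {σ} → from σ)) (λ {σ} → disj σ) (good-skip {S = Wheel} g) (good-firstSpokes m)
  where
  to : ∀ σ → Wheel σ → Skip Wheel σ ⊎ FirstSpokes σ
  to (x ∷ y ∷ outside ∷ outside ∷ σ) w = inj₁ (refl , w)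
  to (x ∷ y ∷ inside  ∷ outside ∷ σ) (inj₁ (t , eq)) = inj₂ ((t , refl) , ∣p∣≡0⇒p≡⊥ σ (ℕ-suc-injective eq))
  to (x ∷ y ∷ outside ∷ inside  ∷ σ) (inj₁ (t , eq)) = inj₂ ((t , refl) , ∣p∣≡0⇒p≡⊥ σ (ℕ-suc-injective eq))
  from : ∀ σ → Skip Wheel σ ⊎ FirstSpokes σ → Wheel σ
  from (x ∷ y ∷ w ∷ w′ ∷ σ) (inj₁ (refl , s)) = s
  from (x ∷ y ∷ inside  ∷ outside ∷ _) (inj₂ ((t , _) , refl)) = inj₁ (t , cong suc (∣⊥∣≡0 m))
  from (x ∷ y ∷ outside ∷ inside  ∷ _) (inj₂ ((t , _) , refl)) = inj₁ (t , cong suc (∣⊥∣≡0 m))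
  disj : ∀ σ → ¬ (Skip Wheel σ × FirstSpokes σ)
  disj (x ∷ y ∷ w ∷ w′ ∷ σ) ((refl , _) , ((_ , ()) , _))

good-wheel : ∀ m → Good (3 + m) Wheel
good-wheel 0             = wheel₃
good-wheel 1             = wheel₄
good-wheel (suc (suc m)) = wheel-step (suc m) (good-wheel m)

-- Induction on the number of groups

Old : Pred (Subset (2 + m)) 0ℓ
Old (x ∷ y ∷ σ) = x ∷ y ∷ [] ≡ ⊥ × Full σ

good-old : Good m Full → Good (2 + m) Old
good-old = good-push raise₂-injective {Full} {Old}
  (λ {σ} f → subst Old (sym (image-raise₂ σ)) (refl , f))
  (λ { {x ∷ y ∷ σ} (refl , f) → σ , f , image-raise₂ σ })

-- Sort by the first two entries. Neither X nor Y: `Old`. Both: `Hub` or `Spokes`, according to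
-- size. Exactly one: `Spokes` or `Fans`, according to size. Wheel and fans differ in the number of
-- groups outside X and Y, at most one against two.
full-step : ∀ m → Good (2 + m) Wheel → Good m Full → Good (2 + m) Full
full-step m w f = good-∪ {S₁ = Old} {S₂ = Wheel ∪ᵖ Fans}
  ((λ {σ} → to σ) , (λ {σ} → from σ)) (λ {σ} → disj σ) (good-old f)
  (good-∪ {S₁ = Wheel} {S₂ = Fans} (id , id) (λ {σ} → disj′ σ) w (good-fans m))
  where
  to : ∀ σ → Full σ → Old σ ⊎ Wheel σ ⊎ Fans σ
  to (inside  ∷ inside  ∷ σ) (inj₁ eq) = inj₂ (inj₁ (inj₂ (_ , ℕ-suc-injective (ℕ-suc-injective eq))))
  to (inside  ∷ inside  ∷ σ) (inj₂ eq) = inj₂ (inj₁ (inj₁ (_ , ℕ-suc-injective (ℕ-suc-injective eq))))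
  to (inside  ∷ outside ∷ σ) (inj₁ eq) = inj₂ (inj₁ (inj₁ (_ , ℕ-suc-injective eq)))
  to (inside  ∷ outside ∷ σ) (inj₂ eq) = inj₂ (inj₂ (_ , ℕ-suc-injective eq))
  to (outside ∷ inside  ∷ σ) (inj₁ eq) = inj₂ (inj₁ (inj₁ (_ , ℕ-suc-injective eq)))
  to (outside ∷ inside  ∷ σ) (inj₂ eq) = inj₂ (inj₂ (_ , ℕ-suc-injective eq))
  to (outside ∷ outside ∷ σ) f         = inj₁ (refl , f)
  from : ∀ σ → Old σ ⊎ Wheel σ ⊎ Fans σ → Full σ
  from (x ∷ y ∷ σ) (inj₁ (refl , f)) = f
  from (inside  ∷ inside  ∷ σ) (inj₂ (inj₁ (inj₁ (_ , eq)))) = inj₂ (cong (2 +_) eq)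
  from (inside  ∷ outside ∷ σ) (inj₂ (inj₁ (inj₁ (_ , eq)))) = inj₁ (cong suc eq)
  from (outside ∷ inside  ∷ σ) (inj₂ (inj₁ (inj₁ (_ , eq)))) = inj₁ (cong suc eq)
  from (inside  ∷ inside  ∷ σ) (inj₂ (inj₁ (inj₂ (_ , eq)))) = inj₁ (cong (2 +_) eq)
  from (inside  ∷ outside ∷ σ) (inj₂ (inj₂ (_ , eq)))        = inj₂ (cong suc eq)
  from (outside ∷ inside  ∷ σ) (inj₂ (inj₂ (_ , eq)))        = inj₂ (cong suc eq)
  disj : ∀ σ → ¬ (Old σ × (Wheel σ ⊎ Fans σ))
  disj (x ∷ y ∷ σ) ((refl , _) , inj₁ (inj₁ (() , _)))
  disj (x ∷ y ∷ σ) ((refl , _) , inj₁ (inj₂ (() , _)))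
  disj (x ∷ y ∷ σ) ((refl , _) , inj₂ (() , _))
  disj′ : ∀ σ → ¬ (Wheel σ × Fans σ)
  disj′ (x ∷ y ∷ σ) (inj₁ (_ , eq) , (_ , eq′)) with () ← trans (sym eq) eq′
  disj′ (x ∷ y ∷ σ) (inj₂ (_ , eq) , (_ , eq′)) with () ← trans (sym eq) eq′

good-full : ∀ m → Good (3 + m) Full
-- Outside X and Y there is a single group, which carries no support of size two or three.
good-full 0             = full-step 1 wheel₃ (decompose-∅ λ e (_ , f) → full₁ (supp 1 e) f)
  where
  full₁ : (σ : Subset 1) → ¬ Full σ
  full₁ (inside  ∷ []) (inj₁ ())
  full₁ (inside  ∷ []) (inj₂ ())
  full₁ (outside ∷ []) (inj₁ ())
  full₁ (outside ∷ []) (inj₂ ())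
-- A separate base case: removing X and Y would leave two groups, whose six points hold no 9-cycle.
good-full 1             = full₄
good-full (suc (suc m)) = full-step (3 + m) (good-wheel (2 + m)) (good-full m)

-- Coordinates given by a one-factor

-- Phrased with positions in the list because these number the groups. Pairwise disjointness relates
-- an earlier entry to a later one, so the two mixed cases use it in opposite orders.
disjoint⇒index-unique : {I : List (Subset v)} → AllPairs (λ e f → Empty (e ∩ f)) I →
  ∀ i j {x} → x ∈ˢ lookupˡ I i → x ∈ˢ lookupˡ I j → i ≡ j
disjoint⇒index-unique (_ ∷ _)  zero    zero    _   _   = refl
disjoint⇒index-unique (d ∷ _)  zero    (suc j) x∈ᵢ x∈ⱼ =
  contradiction (_ , x∈p∩q⁺ (x∈ᵢ , x∈ⱼ)) (All.lookup d (∈-lookup j))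
disjoint⇒index-unique (d ∷ _)  (suc i) zero    x∈ᵢ x∈ⱼ =
  contradiction (_ , x∈p∩q⁺ (x∈ⱼ , x∈ᵢ)) (All.lookup d (∈-lookup i))
disjoint⇒index-unique (_ ∷ ds) (suc i) (suc j) x∈ᵢ x∈ⱼ =
  cong suc (disjoint⇒index-unique ds i j x∈ᵢ x∈ⱼ)

module _ {I : List (Subset v)} (factor : IsOneFactor I) where
  open IsOneFactor factor

  private
    m′ = length I

    listing : (i : Fin m′) → ∃ λ (f : Fin 3 → Fin v) → Injective _≡_ _≡_ f × image f ⊤ ≡ lookupˡ I i
    listing i = enumerate (lookupˡ I i) (All.lookup triples (∈-lookup i))

  place : Fin m′ → Fin 3 → Fin v
  place i = proj₁ (listing i)

  image-place : ∀ i → image (place i) ⊤ ≡ lookupˡ I i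
  image-place i = proj₂ (proj₂ (listing i))

  place-∈ : ∀ i r → place i r ∈ˢ lookupˡ I i
  place-∈ i r = subst (place i r ∈ˢ_) (image-place i) (∈-image⁺ (place i) ∈⊤)

  place-injective : ∀ {i j r s} → place i r ≡ place j s → (i , r) ≡ (j , s)
  place-injective {i} {j} {r} {s} eq
    with refl ← disjoint⇒index-unique disjoint i j (place-∈ i r) (subst (_∈ˢ _) (sym eq) (place-∈ j s))
    = cong (i ,_) (proj₁ (proj₂ (listing i)) eq)

  -- The bijection that identifies group `i` with the triple at position `i` of `I`. Disjointness
  -- makes it injective, covering makes it surjective.
  coordinates : Fin (m′ * 3) → Fin v
  coordinates x = place (quotient 3 x) (remainder {m′} 3 x)

  coordinates-combine : ∀ i r → coordinates (combine i r) ≡ place i r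
  coordinates-combine i r = cong (λ (i , r) → place i r) (remQuot-combine i r)

  coordinates-injective : Injective _≡_ _≡_ coordinates
  coordinates-injective {x} {y} eq = trans (sym (combine-remQuot {m′} 3 x))
    (trans (cong (λ (i , r) → combine i r) (place-injective eq)) (combine-remQuot {m′} 3 y))

  coordinates-surjective : ∀ y → ∃ λ x → coordinates x ≡ y
  coordinates-surjective y =
    let i = Any.index (covers y)
        r , _ , eq = ∈-image⁻ (place i) ⊤ (subst (y ∈ˢ_) (sym (image-place i)) (Anyₚ.lookup-index (covers y)))
    in  combine i r , trans (coordinates-combine i r) eq

  group : Fin m′ → Subset (m′ * 3)
  group i = image (combine i) ⊤

  image-group : ∀ i → image coordinates (group i) ≡ lookupˡ I i
  image-group i = begin
    image coordinates (group i)          ≡⟨ image-∘ coordinates (combine i) ⊤ ⟨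
    image (coordinates ∘ combine i) ⊤    ≡⟨ image-cong (coordinates-combine i) ⊤ ⟩
    image (place i) ⊤                    ≡⟨ image-place i ⟩
    lookupˡ I i                          ∎
    where open ≡-Reasoning

  supp-group : ∀ i → supp m′ (group i) ≡ ⁅ i ⁆
  supp-group i = trans (sym (image-∘ (quotient 3) (combine i) ⊤)) (image-unique (quotient 3 ∘ combine i) ⊤
    (λ {r} _ → subst (_∈ˢ ⁅ i ⁆) (sym (quotient-combine r)) (x∈⁅x⁆ i))
    (λ j∈ → zero , ∈⊤ , trans (quotient-combine zero) (sym (x∈⁅y⁆⇒x≡y i j∈))))
    where
    quotient-combine : (r : Fin 3) → quotient 3 (combine i r) ≡ i
    quotient-combine r = cong proj₁ (remQuot-combine i r)

  -- All three vertices of `e` lie in one group, which has only three points.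
  supp-singleton : ∀ e i → ∣ e ∣ ≡ 3 → supp m′ e ≡ ⁅ i ⁆ → e ≡ group i
  supp-singleton e i ∣e∣≡3 supp≡ with image-surjective (combine i) e covered
    where
    covered : ∀ {y} → y ∈ˢ e → ∃ λ r → combine i r ≡ y
    covered {y} y∈ = remainder {m′} 3 y , trans
      (cong (λ j → combine j (remainder {m′} 3 y))
        (sym (x∈⁅y⁆⇒x≡y i (subst (_ ∈ˢ_) supp≡ (∈-image⁺ (quotient {m′} 3) y∈)))))
      (combine-remQuot {m′} 3 y)
  ... | p , refl = cong (image (combine i)) {p} {⊤}
    (∣p∣≡n⇒p≡⊤ (trans (sym (∣image∣≡ (combine-injectiveʳ i _ i _) p)) ∣e∣≡3))

  -- As an image of `e` the support has at most three elements. An empty support would make `e`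
  -- empty, and a singleton support would make it a group.
  supp-size : ∀ e → ∣ e ∣ ≡ 3 → (∀ i → e ≢ group i) → Full (supp m′ e)
  supp-size e ∣e∣≡3 e≢ = two-or-three _
    (≤-trans (∣image∣≤ (quotient {m′} 3) e) (≤-reflexive ∣e∣≡3)) ∣supp∣≢0 ∣supp∣≢1
    where
    two-or-three : ∀ k → k ≤ 3 → k ≢ 0 → k ≢ 1 → k ≡ 2 ⊎ k ≡ 3
    two-or-three 0 _ k≢0 _ = contradiction refl k≢0
    two-or-three 1 _ _ k≢1 = contradiction refl k≢1
    two-or-three 2 _ _ _   = inj₁ refl
    two-or-three 3 _ _ _   = inj₂ refl
    two-or-three (suc (suc (suc (suc _)))) (s≤s (s≤s (s≤s ())))

    ∣supp∣≢0 : ∣ supp m′ e ∣ ≢ 0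
    ∣supp∣≢0 eq = contradiction (trans (sym ∣e∣≡3) (trans (cong ∣_∣ e≡⊥) (∣⊥∣≡0 (m′ * 3)))) λ ()
      where
      e≡⊥ : e ≡ ⊥
      e≡⊥ = Empty-unique λ (_ , x∈) →
        ∉⊥ (subst (_ ∈ˢ_) (∣p∣≡0⇒p≡⊥ (supp m′ e) eq) (∈-image⁺ (quotient {m′} 3) x∈))

    ∣supp∣≢1 : ∣ supp m′ e ∣ ≢ 1
    ∣supp∣≢1 eq =
      let φ , _ , φ⊤≡ = enumerate (supp m′ e) eq
      -- For a map on `Fin 1`, `image φ ⊤` unfolds to the union of the singleton of `φ zero` with
      -- `⊥`.
      in  e≢ (φ zero) (supp-singleton e (φ zero) ∣e∣≡3 (trans (sym φ⊤≡) (∪-identityʳ ⁅ φ zero ⁆)))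

  group-not-full : ∀ i → ¬ Full (supp m′ (group i))
  group-not-full i = [ (λ eq → contradiction (trans (sym ∣supp∣≡1) eq) λ ())
                     , (λ eq → contradiction (trans (sym ∣supp∣≡1) eq) λ ()) ]′
    where
    ∣supp∣≡1 : ∣ supp m′ (group i) ∣ ≡ 1
    ∣supp∣≡1 = trans (cong ∣_∣ (supp-group i)) (∣⁅x⁆∣≡1 i)

  -- The triples of `I` are exactly the images of the groups, and a group has a one-element support,
  -- so it is never full.
  push-full⊆ : Push coordinates ⟨ Full {m′} ⟩ ⊆ K⁽³⁾ v minus I
  push-full⊆ {e′} (e , (∣e∣≡3 , full) , e′≡) =
    trans (cong ∣_∣ e′≡) (trans (∣image∣≡ coordinates-injective e) ∣e∣≡3) , e′∉I
    where
    e′∉I : ¬ e′ ∈ˡ I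
    e′∉I e′∈I = group-not-full i (subst (λ e → Full (supp m′ e)) e≡group full)
      where
      i = Any.index e′∈I
      e≡group : e ≡ group i
      e≡group = image-injective coordinates-injective
        (trans (sym e′≡) (trans (Anyₚ.lookup-index e′∈I) (sym (image-group i))))

  push-full⊇ : K⁽³⁾ v minus I ⊆ Push coordinates ⟨ Full {m′} ⟩
  push-full⊇ {e′} (∣e′∣≡3 , e′∉I) = e , (∣e∣≡3 , supp-size e ∣e∣≡3 e≢group) , sym ce≡e′
    where
    preimage : ∃ λ e → image coordinates e ≡ e′
    preimage = image-surjective coordinates e′ (λ {y} _ → coordinates-surjective y)
    e = proj₁ preimage
    ce≡e′ = proj₂ preimage
    ∣e∣≡3 : ∣ e ∣ ≡ 3
    ∣e∣≡3 = trans (sym (∣image∣≡ coordinates-injective e)) (trans (cong ∣_∣ ce≡e′) ∣e′∣≡3)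
    e≢group : ∀ i → e ≢ group i
    e≢group i e≡ = e′∉I (subst (_∈ˡ I)
      (sym (trans (sym ce≡e′) (trans (cong (image coordinates) e≡) (image-group i)))) (∈-lookup i))

-- Necessity, and the equivalence

decomposition⇒9≤v : {H : Hypergraph v} → Decomposition H → ∃ H → 9 ≤ v
decomposition⇒9≤v d (e , e∈H) =
  injective⇒≤ (TightCycle.distinct (proj₁ (Any.satisfied (TightCycleDecomposition.covers d e e∈H))))

-- Among the multiples of 3 that are at least 4 only 6 is below 9. An edge there rules out the empty
-- decomposition and so forces a 9-cycle.
edge-exists : {I : List (Subset v)} → IsOneFactor I → length I ≡ 2 → ∃ (K⁽³⁾ v minus I)
edge-exists {I = I} factor ∣I∣≡2 =
  let e , e∈ = edge (length I) ∣I∣≡2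
  in  _ , push-full⊆ factor (e , e∈ , refl)
  where
  edge : ∀ m → m ≡ 2 → ∃ (⟨ Full {m} ⟩)
  -- The triple {0, 1, 3}: two points of the first group and one of the second.
  edge _ refl = inside ∷ inside ∷ outside ∷ inside ∷ outside ∷ outside ∷ [] , refl , inj₁ refl

theorem3 : (v : ℕ) → v ≥ 4 → 3 ∣ v → (I : List (Subset v)) → IsOneFactor I →
    TightCycleDecomposition 9 (K⁽³⁾ v minus I) ⇔ v ≥ 9
theorem3 v v≥4 (divides q refl) I factor = mk⇔ (necessary q v≥4 ∣I∣≡q) (sufficient q ∣I∣≡q)
  where
  ∣I∣≡q : length I ≡ q
  ∣I∣≡q = trans (IsOneFactor.size factor) (m*n/n≡m q 3)

  necessary : ∀ k → k * 3 ≥ 4 → length I ≡ k → Decomposition (K⁽³⁾ v minus I) → k * 3 ≥ 9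
  necessary 1 (s≤s (s≤s (s≤s ())))
  -- Here v = 6 and the goal is the false inequality 6 ≥ 9, which the nine distinct vertices of a
  -- cycle provide.
  necessary 2 _ ∣I∣≡2 d =
    subst (9 ≤_) (cong (_* 3) (trans (sym ∣I∣≡q) ∣I∣≡2)) (decomposition⇒9≤v d (edge-exists factor ∣I∣≡2))
  necessary (suc (suc (suc k))) _ _ _ = s≤s (s≤s (s≤s (s≤s (s≤s (s≤s (s≤s (s≤s (s≤s z≤n))))))))

  sufficient : ∀ k → length I ≡ k → k * 3 ≥ 9 → Decomposition (K⁽³⁾ v minus I)
  sufficient 0 _ ()
  sufficient 1 _ (s≤s (s≤s (s≤s ())))
  sufficient 2 _ (s≤s (s≤s (s≤s (s≤s (s≤s (s≤s ()))))))
  sufficient (suc (suc (suc k))) ∣I∣≡k _ = decompose-≐ (push-full⊆ factor , push-full⊇ factor)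
    (decompose-push (coordinates-injective factor) (subst (λ m → Good m Full) (sym ∣I∣≡k) (good-full k)))
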